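{- For $n\geq2$ and $0\leq t\leq n-2$, the number of Fibonacci polyominoes $P\in\mathcal F_{n,n}$ with $\operatorname{lev}(P)=t$ equals \[ \binom{n-2}{t}M_{n-2-t}, \] where $M_k$ is the $k$th Motzkin number. The number is $0$ for $t>n-2$. In particular, the number of $P\in\mathcal F_{n,n}$ with $\operatorname{lev}(P)=0$ is $M_{n-2}$.
   Context: A Fibonacci polyomino is a (nonempty) polyomino, considered up to translation, that is column-convex (each column is a contiguous segment of unit cells) and such that, reading columns from left to right, the bottom cell of each column lies exactly one unit above the bottom cell of the preceding column. Equivalently, it is given by a sequence of column heights $(h_1,\dots,h_m)$, $m\ge 1$, with $h_i\ge 2$ for $1\le i\le m-1$ and $h_m\ge 1$; column $i$ consists of the cells in column position $i$ and rows $i,i+1,\dots,i+h_i-1$. The horizontal (resp. vertical) semiperimeter is half the number of horizontal (resp. vertical) unit edges on the boundary (edges belonging to exactly one cell). $\mathcal F_{n,n}$ is the set of Fibonacci polyominoes with horizontal semiperimeter $n$ (equivalently $n$ columns) and vertical semiperimeter $n$. For $P$ with column heights $(h_1,\ldots,h_n)$: $\operatorname{lev}(P)=|\{i:1\le i<n,\ h_i=h_{i+1}\}|$. Motzkin numbers: $M_k=\sum_{i\ge0}\binom{k}{2i}C_i$ with $C_i=\frac1{i+1}\binom{2i}{i}$, so $M_0,M_1,M_2,\ldots=1,1,2,4,9,21,\ldots$. -}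

module Defs where

open import Data.Bool using (if_then_else_)
open import Data.List using (List; []; _∷_; [_]; _++_; length; map; filter; concatMap; upTo)
open import Data.List.Membership.Propositional using (_∈_)
open import Data.List.Relation.Unary.Unique.Propositional using (Unique)
open import Data.Nat using (ℕ; suc; _+_; _*_; _≤_; _/_; _≟_)
open import Data.Nat.Combinatorics using (_C_)
open import Data.Nat.ListAction using (sum)
open import Data.Product using (∃-syntax; _×_; _,_)
open import Data.Product.Properties using (≡-dec)
open import Function.Bundles using (_⇔_)
open import Relation.Binary.Definitions using (DecidableEquality)
open import Relation.Binary.PropositionalEquality using (_≡_)
open import Relation.Nullary using (does)
import Data.List.Membership.DecPropositional as DecMembership

-- A Fibonacci polyomino (up to translation) is represented by its sequence of
-- column heights (h₁ , … , hₘ), m ≥ 1, with hᵢ ≥ 2 for i < m and hₘ ≥ 1.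
data IsFibonacci : List ℕ → Set where
  last : ∀ {h} → 1 ≤ h → IsFibonacci [ h ]
  next : ∀ {h hs} → 2 ≤ h → IsFibonacci hs → IsFibonacci (h ∷ hs)

-- (x , y) is the unit cell in column x and row y, with corners
-- (x , y), (x+1 , y), (x , y+1), (x+1 , y+1).
Cell : Set
Cell = ℕ × ℕ

-- Column i of height h occupies rows i, i+1, …, i+h-1.
column : ℕ → ℕ → List Cell
column i h = map (λ k → i , i + k) (upTo h)

cellsFrom : ℕ → List ℕ → List Cell
cellsFrom i []       = []
cellsFrom i (h ∷ hs) = column i h ++ cellsFrom (suc i) hs

cells : List ℕ → List Cell
cells = cellsFrom 1

-- A unit edge of known direction is named by its left (horizontal edge) or
-- lower (vertical edge) endpoint.
Edge : Set
Edge = ℕ × ℕ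

_≟ᴱ_ : DecidableEquality Edge
_≟ᴱ_ = ≡-dec _≟_ _≟_

open DecMembership _≟ᴱ_ using (_∈?_)

horizontalEdges : Cell → List Edge
horizontalEdges (x , y) = (x , y) ∷ (x , suc y) ∷ []

verticalEdges : Cell → List Edge
verticalEdges (x , y) = (x , y) ∷ (suc x , y) ∷ []

cellsContaining : (Cell → List Edge) → List Cell → Edge → List Cell
cellsContaining edges cs e = filter (λ c → e ∈? edges c) cs

-- An edge belonging to exactly one cell is listed exactly once by
-- concatMap edges cs, so the result is free of repetitions.
boundary : (Cell → List Edge) → List Cell → List Edge
boundary edges cs =
  filter (λ e → length (cellsContaining edges cs e) ≟ 1) (concatMap edges cs)

-- The semiperimeters are halves of edge counts; stated without division.
HorizontalSemiperimeter : List ℕ → ℕ → Set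
HorizontalSemiperimeter P n = length (boundary horizontalEdges (cells P)) ≡ 2 * n

VerticalSemiperimeter : List ℕ → ℕ → Set
VerticalSemiperimeter P m = length (boundary verticalEdges (cells P)) ≡ 2 * m

-- 𝓕 n m P : P is a Fibonacci polyomino with horizontal semiperimeter n and
-- vertical semiperimeter m.
𝓕 : ℕ → ℕ → List ℕ → Set
𝓕 n m P = IsFibonacci P × HorizontalSemiperimeter P n × VerticalSemiperimeter P m

lev : List ℕ → ℕ
lev []           = 0
lev (_ ∷ [])     = 0
lev (a ∷ b ∷ hs) = (if does (a ≟ b) then 1 else 0) + lev (b ∷ hs)

catalan : ℕ → ℕ
catalan i = ((2 * i) C i) / suc i

-- The terms with i > k of the defining series vanish.
motzkin : ℕ → ℕ
motzkin k = sum (map (λ i → (k C (2 * i)) * catalan i) (upTo (suc k)))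

-- The set {x | Q x} is finite with exactly k elements.
HasCardinality : {A : Set} → (A → Set) → ℕ → Set
HasCardinality Q k =
  ∃[ xs ] Unique xs × (∀ x → x ∈ xs ⇔ Q x) × length xs ≡ k

{-# OPTIONS --safe #-}

-- The vertical semiperimeter of (h₁, …, hₘ) is hₘ + ∑ (1 + max(0, hᵢ − hᵢ₊₁ − 1)),
-- so 𝓕 n n consists of the height sequences with hₙ = 1 and 2 ≤ hᵢ ≤ hᵢ₊₁ + 1 for
-- i < n. Read from right to left after the forced hₙ₋₁ = 2, such a sequence is a
-- nonnegative walk of n − 2 steps, each at most +1, starting at 0. Choosing the
-- positions of its t level steps leaves a walk of n − 2 − t steps with no level
-- step. If μ(k, j) counts the Motzkin paths of k steps from height j to 0, then
-- ∑ⱼ C(a, j) μ(k, j) satisfies the recurrence of the level-free k-step walks from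
-- a, and at a = 0 it is the Motzkin number; the latter's explicit formula follows
-- from μ(k, j) = ∑ₙ C(k, n) D(n, j) with D the ballot numbers.
module Submission where

open import Defs
open import Data.Bool using (if_then_else_; true; false)
open import Data.Empty using (⊥-elim)
open import Data.List using (List; []; _∷_; [_]; _++_; applyUpTo; concatMap; drop; filter; length; map; upTo)
open import Data.List.Membership.Propositional using (_∈_; find; lose)
open import Data.List.Membership.Propositional.Properties using (∈-concatMap⁺; ∈-concatMap⁻; ∈-filter⁺; ∈-filter⁻; ∈-upTo⁺; ∈-upTo⁻)
open import Data.List.Properties using (drop-drop; map-++; map-cong; map-upTo; map-∘; ∷-injectiveˡ)
open import Data.List.Relation.Unary.All using (All; []; _∷_)
open import Data.List.Relation.Unary.Any using (here; there)
open import Data.List.Relation.Unary.Unique.Propositional using (Unique)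
open import Data.Nat
open import Data.Nat.Combinatorics using (_C_; k>n⇒nCk≡0; nC1≡n; nCk+nC[k+1]≡[n+1]C[k+1]; nCk≡nC[n∸k])
open import Data.Nat.DivMod using (/-congˡ; m*n/n≡m)
open import Data.Nat.ListAction using (sum)
open import Data.Nat.ListAction.Properties using (sum-++)
open import Data.Nat.Properties
open import Data.Nat.Tactic.RingSolver using (solve-∀)
open import Data.Product using (_×_; _,_; proj₁; proj₂; ∃-syntax)
open import Function using (_∘_; _⇔_; mk⇔; Equivalence)
open import Relation.Binary.PropositionalEquality using (_≡_; _≢_; _≗_; refl; sym; ≢-sym; trans; cong; cong₂; subst; module ≡-Reasoning)
open import Relation.Nullary using (Dec; does; no; yes; ¬_)
open import Relation.Unary using (Decidable)
import Data.List.Membership.DecPropositional as DecMembership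
import Data.List.Relation.Unary.All as All
import Data.List.Relation.Unary.All.Properties as All
import Data.List.Relation.Unary.AllPairs as AllPairs
import Data.List.Relation.Unary.AllPairs.Properties as AllPairs
import Data.List.Relation.Unary.Unique.Propositional.Properties as Unique

open DecMembership _≟ᴱ_ using (_∈?_)
open ≡-Reasoning

-- Binomial transforms, ballot numbers and Motzkin numbers

+-interchange : ∀ a b c d → (a + b) + (c + d) ≡ (a + c) + (b + d)
+-interchange = solve-∀

pascal : ∀ n k → suc n C suc k ≡ n C k + n C suc k
pascal n k = sym (nCk+nC[k+1]≡[n+1]C[k+1] n k)

-- The absorption identity (k + 1) C(n, k + 1) = (n - k) C(n, k) without subtraction.
C-absorption : ∀ n k → suc k * (n C suc k) + k * (n C k) ≡ n * (n C k)
C-absorption zero zero = refl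
C-absorption zero (suc k) = cong₂ _+_ (*-zeroʳ (suc (suc k))) (*-zeroʳ (suc k))
C-absorption (suc n) zero = begin
  1 * (suc n C 1) + 0  ≡⟨ +-identityʳ _ ⟩
  1 * (suc n C 1)      ≡⟨ *-identityˡ _ ⟩
  suc n C 1            ≡⟨ nC1≡n (suc n) ⟩
  suc n                ≡⟨ *-identityʳ (suc n) ⟨
  suc n * 1            ∎
C-absorption (suc n) (suc k) = begin
  (2 + k) * (suc n C (2 + k)) + (1 + k) * (suc n C suc k)
    ≡⟨ cong₂ (λ u v → (2 + k) * u + (1 + k) * v) (pascal n (suc k)) (pascal n k) ⟩
  (2 + k) * (b + c) + (1 + k) * (a + b)
    ≡⟨ regroup k a b c ⟩
  ((2 + k) * c + (1 + k) * b) + ((1 + k) * b + k * a) + (a + b)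
    ≡⟨ cong₂ (λ u v → u + v + (a + b)) (C-absorption n (suc k)) (C-absorption n k) ⟩
  n * b + n * a + (a + b)
    ≡⟨ collect n a b ⟩
  suc n * (a + b)
    ≡⟨ cong (suc n *_) (pascal n k) ⟨
  suc n * (suc n C suc k) ∎
  where
  a = n C k
  b = n C suc k
  c = n C suc (suc k)
  regroup : ∀ k a b c → (2 + k) * (b + c) + (1 + k) * (a + b)
                      ≡ ((2 + k) * c + (1 + k) * b) + ((1 + k) * b + k * a) + (a + b)
  regroup = solve-∀
  collect : ∀ n a b → n * b + n * a + (a + b) ≡ suc n * (a + b)
  collect = solve-∀

-- binomialTransform f k is the sum of C(k, i) f(i) over i ≤ k.
binomialTransform : (ℕ → ℕ) → ℕ → ℕ
binomialTransform f zero    = f 0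
binomialTransform f (suc k) = binomialTransform f k + binomialTransform (f ∘ suc) k

binomialTransform-cong : ∀ {f g} → f ≗ g → binomialTransform f ≗ binomialTransform g
binomialTransform-cong f≗g zero    = f≗g 0
binomialTransform-cong f≗g (suc k) =
  cong₂ _+_ (binomialTransform-cong f≗g k) (binomialTransform-cong (f≗g ∘ suc) k)

binomialTransform-+ : ∀ f g k → binomialTransform (λ i → f i + g i) k
                              ≡ binomialTransform f k + binomialTransform g k
binomialTransform-+ f g zero    = refl
binomialTransform-+ f g (suc k) = begin
  binomialTransform (λ i → f i + g i) k + binomialTransform (λ i → f (suc i) + g (suc i)) k
    ≡⟨ cong₂ _+_ (binomialTransform-+ f g k) (binomialTransform-+ (f ∘ suc) (g ∘ suc) k) ⟩
  (binomialTransform f k + binomialTransform g k) + (binomialTransform (f ∘ suc) k + binomialTransform (g ∘ suc) k)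
    ≡⟨ +-interchange (binomialTransform f k) _ _ _ ⟩
  (binomialTransform f k + binomialTransform (f ∘ suc) k) + (binomialTransform g k + binomialTransform (g ∘ suc) k) ∎

binomialTransform-0 : ∀ k → binomialTransform (λ _ → 0) k ≡ 0
binomialTransform-0 zero    = refl
binomialTransform-0 (suc k) = cong₂ _+_ (binomialTransform-0 k) (binomialTransform-0 k)

-- The value 0 at 0 has two uses: in `ballot` it is the barrier that forbids a step below height 0,
-- and in `pascalʳ` it is the convention C(n, -1) = 0.
shiftʳ : (ℕ → ℕ) → ℕ → ℕ
shiftʳ f zero    = 0
shiftʳ f (suc j) = f j

sumBelow : ℕ → (ℕ → ℕ) → ℕ
sumBelow n f = sum (applyUpTo f n)

sumBelow-cong : ∀ n {f g} → f ≗ g → sumBelow n f ≡ sumBelow n g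
sumBelow-cong zero    f≗g = refl
sumBelow-cong (suc n) f≗g = cong₂ _+_ (f≗g 0) (sumBelow-cong n (f≗g ∘ suc))

sumBelow-cong-< : ∀ n {f g} → (∀ k → k < n → f k ≡ g k) → sumBelow n f ≡ sumBelow n g
sumBelow-cong-< zero    eq = refl
sumBelow-cong-< (suc n) eq = cong₂ _+_ (eq 0 z<s) (sumBelow-cong-< n (λ k k<n → eq (suc k) (s<s k<n)))

sumBelow-0 : ∀ n {f} → (∀ i → f i ≡ 0) → sumBelow n f ≡ 0
sumBelow-0 zero    f≗0 = refl
sumBelow-0 (suc n) f≗0 = cong₂ _+_ (f≗0 0) (sumBelow-0 n (f≗0 ∘ suc))

sumBelow-+ : ∀ n f g → sumBelow n (λ i → f i + g i) ≡ sumBelow n f + sumBelow n g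
sumBelow-+ zero    f g = refl
sumBelow-+ (suc n) f g = trans (cong (f 0 + g 0 +_) (sumBelow-+ n (f ∘ suc) (g ∘ suc)))
                               (+-interchange (f 0) (g 0) _ _)

sumBelow-* : ∀ n c f → sumBelow n (λ i → c * f i) ≡ c * sumBelow n f
sumBelow-* zero    c f = sym (*-zeroʳ c)
sumBelow-* (suc n) c f = trans (cong (c * f 0 +_) (sumBelow-* n c (f ∘ suc)))
                               (sym (*-distribˡ-+ c (f 0) _))

sumBelow-suc : ∀ n f → sumBelow (suc n) f ≡ sumBelow n f + f n
sumBelow-suc zero    f = +-identityʳ (f 0)
sumBelow-suc (suc n) f = trans (cong (f 0 +_) (sumBelow-suc n (f ∘ suc))) (sym (+-assoc (f 0) _ _))

-- The binomial transform turns a Motzkin step (−1, 0 or +1) into a step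
-- that rises by one or falls by any positive amount.
binomialTransform-motzkinStep : ∀ f a →
  binomialTransform (λ j → f j + (f (suc j) + shiftʳ f j)) a
    ≡ sumBelow a (binomialTransform f) + binomialTransform f (suc a)
binomialTransform-motzkinStep f zero    = cong (f 0 +_) (+-identityʳ (f 1))
binomialTransform-motzkinStep f (suc a) = begin
  binomialTransform (λ j → f j + (f (suc j) + shiftʳ f j)) a
    + binomialTransform (λ j → f₁ j + (f₂ j + f j)) a
    ≡⟨ cong₂ _+_ (binomialTransform-motzkinStep f a)
        (trans (binomialTransform-+ f₁ _ a) (cong (binomialTransform f₁ a +_) (binomialTransform-+ f₂ f a))) ⟩
  (sumBelow a (binomialTransform f) + binomialTransform f (suc a))
    + (binomialTransform f₁ a + (binomialTransform f₂ a + binomialTransform f a))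
    ≡⟨ regroup (sumBelow a (binomialTransform f)) (binomialTransform f (suc a)) (binomialTransform f₁ a) (binomialTransform f₂ a) (binomialTransform f a) ⟩
  (sumBelow a (binomialTransform f) + binomialTransform f a) + binomialTransform f (2 + a)
    ≡⟨ cong (_+ binomialTransform f (2 + a)) (sumBelow-suc a (binomialTransform f)) ⟨
  sumBelow (suc a) (binomialTransform f) + binomialTransform f (2 + a) ∎
  where
  f₁ = f ∘ suc
  f₂ = f ∘ suc ∘ suc
  regroup : ∀ s u v w x → (s + u) + (v + (w + x)) ≡ (s + x) + (u + (v + w))
  regroup = solve-∀

-- The number of n-step ±1 paths from height j to 0 that stay nonnegative.
ballot : ℕ → ℕ → ℕ
ballot zero    zero    = 1
ballot zero    (suc j) = 0
ballot (suc n) j       = ballot n (suc j) + shiftʳ (ballot n) j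

ballot-<0 : ∀ n j → n < j → ballot n j ≡ 0
ballot-<0 zero    (suc j) _         = refl
ballot-<0 (suc n) (suc j) (s≤s n<j) =
  cong₂ _+_ (ballot-<0 n (2 + j) (m≤n⇒m≤1+n (m≤n⇒m≤1+n n<j))) (ballot-<0 n j n<j)

ballot-diagonal : ∀ n → ballot n n ≡ 1
ballot-diagonal zero    = refl
ballot-diagonal (suc n) = cong₂ _+_ (ballot-<0 n (2 + n) (m≤n⇒m≤1+n ≤-refl)) (ballot-diagonal n)

-- Each step changes the parity of the height, so a path from `j` to 0 in `n` steps needs `n + j`
-- even.
ballot-odd : ∀ n j m → n + j ≡ suc (m + m) → ballot n j ≡ 0
ballot-odd zero    (suc j) m eq = refl
ballot-odd (suc n) zero    m eq =
  trans (+-identityʳ _) (ballot-odd n 1 m (trans (+-suc n 0) eq))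
ballot-odd (suc n) (suc j) zero eq = ⊥-elim (1+n≢0 (trans (sym (+-suc n j)) (suc-injective eq)))
ballot-odd (suc n) (suc j) (suc m) eq = cong₂ _+_
  (ballot-odd n (2 + j) (suc m) (trans (+-suc n (suc j)) eq))
  (ballot-odd n j m (suc-injective (suc-injective (trans (sym (cong suc (+-suc n j))) (trans eq (cong (suc ∘ suc) (+-suc m m)))))))

central-symmetry : ∀ i → suc (i + i) C suc i ≡ suc (i + i) C i
central-symmetry i = trans (nCk≡nC[n∸k] (s≤s (m≤m+n i i))) (cong (suc (i + i) C_) (m+n∸n≡m i i))

pascalʳ : ∀ n k → suc n C k ≡ shiftʳ (n C_) k + n C k
pascalʳ n zero    = refl
pascalʳ n (suc k) = pascal n k

-- Of the C(n, i) unrestricted paths, shiftʳ (n C_) i = C(n, i − 1) visit −1, by reflection.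
ballot-reflection : ∀ n i j → n ≡ i + i + j → ballot n j + shiftʳ (n C_) i ≡ n C i
ballot-reflection n       zero    j       refl = trans (+-identityʳ _) (ballot-diagonal n)
ballot-reflection (suc n) (suc i) zero    eq   = begin
  ballot n 1 + 0 + suc n C i                   ≡⟨ cong₂ _+_ (+-identityʳ _) (pascalʳ n i) ⟩
  ballot n 1 + (shiftʳ (n C_) i + n C i)       ≡⟨ +-assoc (ballot n 1) _ _ ⟨
  ballot n 1 + shiftʳ (n C_) i + n C i         ≡⟨ cong (_+ n C i) (ballot-reflection n i 1 (trans n≡ (+-comm 1 (i + i)))) ⟩
  -- At height 0 only the step up exists. The second summand, which a step down would otherwise
  -- supply, comes from the symmetry of the odd row `n = suc (i + i)`.
  n C i + n C i                                ≡⟨ cong (λ m → n C i + m) symmetry ⟨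
  n C i + n C suc i                            ≡⟨ pascal n i ⟨
  suc n C suc i                                ∎
  where
  n≡ : n ≡ suc (i + i)
  n≡ = trans (suc-injective eq) (trans (+-identityʳ _) (+-suc i i))
  symmetry : n C suc i ≡ n C i
  symmetry = subst (λ m → m C suc i ≡ m C i) (sym n≡) (central-symmetry i)
ballot-reflection (suc n) (suc i) (suc j) eq   = begin
  ballot n (2 + j) + ballot n j + suc n C i
    ≡⟨ cong (ballot n (2 + j) + ballot n j +_) (pascalʳ n i) ⟩
  ballot n (2 + j) + ballot n j + (shiftʳ (n C_) i + n C i)
    ≡⟨ +-interchange (ballot n (2 + j)) _ _ _ ⟩
  (ballot n (2 + j) + shiftʳ (n C_) i) + (ballot n j + n C i)
    ≡⟨ cong₂ _+_ (ballot-reflection n i (2 + j) (trans (suc-injective eq) (first i j)))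
                 (ballot-reflection n (suc i) j (trans (suc-injective eq) (second i j))) ⟩
  n C i + n C suc i
    ≡⟨ pascal n i ⟨
  suc n C suc i ∎
  where
  first : ∀ i j → i + suc i + suc j ≡ i + i + (2 + j)
  first = solve-∀
  second : ∀ i j → i + suc i + suc j ≡ suc (i + suc i + j)
  second = solve-∀

-- Multiplying by `suc i` makes the truncated division in `catalan` exact; the central binomial
-- coefficient then comes from reflection and absorption.
ballot-catalan : ∀ i → ballot (2 * i) 0 ≡ catalan i
ballot-catalan i = begin
  ballot (2 * i) 0                     ≡⟨ m*n/n≡m (ballot (2 * i) 0) (suc i) ⟨
  (ballot (2 * i) 0 * suc i) / suc i   ≡⟨ /-congˡ (trans (*-comm _ (suc i)) (scaled i)) ⟩
  catalan i                            ∎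
  where
  double : ∀ i → 2 * i ≡ i + i + 0
  double = solve-∀
  scaled : ∀ i → suc i * ballot (2 * i) 0 ≡ (2 * i) C i
  scaled zero    = refl
  scaled (suc i) = begin
    (2 + i) * d      ≡⟨⟩
    -- The needed identity `(1 + i) * d ≡ c` is reached after adding `(1 + 2 * i) * c` to both
    -- sides: this creates `d + c`, which reflection turns into `n C suc i`, and absorption applies
    -- without subtraction.
    d + (1 + i) * d  ≡⟨ cong (d +_) (+-cancelʳ-≡ ((1 + 2 * i) * c) _ _ cancelled) ⟩
    d + c            ≡⟨ reflection ⟩
    n C suc i        ∎
    where
    n = 2 * suc i
    d = ballot n 0
    c = n C i
    reflection : ballot n 0 + n C i ≡ n C suc i
    reflection = ballot-reflection n (suc i) 0 (double (suc i))
    regroup : ∀ i d c → (1 + i) * d + (1 + 2 * i) * c ≡ (1 + i) * (d + c) + i * c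
    regroup = solve-∀
    collect : ∀ i c → 2 * suc i * c ≡ c + (1 + 2 * i) * c
    collect = solve-∀
    cancelled : (1 + i) * d + (1 + 2 * i) * c ≡ c + (1 + 2 * i) * c
    cancelled = begin
      (1 + i) * d + (1 + 2 * i) * c    ≡⟨ regroup i d c ⟩
      (1 + i) * (d + c) + i * c        ≡⟨ cong (λ b → (1 + i) * b + i * c) reflection ⟩
      (1 + i) * (n C suc i) + i * c    ≡⟨ C-absorption n i ⟩
      n * c                            ≡⟨ collect i c ⟩
      c + (1 + 2 * i) * c              ∎

-- From ballot numbers to the explicit Motzkin formula

interleave : (ℕ → ℕ) → ℕ → ℕ
interleave e zero          = e 0
interleave e (suc zero)    = 0
interleave e (suc (suc n)) = interleave (e ∘ suc) n

interleave-unique : ∀ e f → (∀ i → f (2 * i) ≡ e i) → (∀ i → f (suc (2 * i)) ≡ 0) → f ≗ interleave e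
interleave-unique e f evens odds zero          = evens 0
interleave-unique e f evens odds (suc zero)    = odds 0
interleave-unique e f evens odds (suc (suc n)) =
  interleave-unique (e ∘ suc) (f ∘ suc ∘ suc)
    (λ i → trans (cong f (sym (*-suc 2 i))) (evens (suc i)))
    (λ i → trans (cong (f ∘ suc) (sym (*-suc 2 i))) (odds (suc i))) n

interleave-suc : ∀ e n → shiftʳ (interleave (e ∘ suc)) n ≡ interleave e (suc n)
interleave-suc e zero    = refl
interleave-suc e (suc n) = refl

evenSum oddSum : ℕ → ℕ → (ℕ → ℕ) → ℕ
evenSum N k e = sumBelow N (λ i → (k C (2 * i)) * e i)
oddSum  N k e = sumBelow N (λ i → (k C suc (2 * i)) * e i)

-- By Pascal's rule. The term at index 0 yields no odd term, hence the shifted `e` and one term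
-- fewer in the odd sum.
evenSum-suc : ∀ N k e → evenSum (suc N) (suc k) e ≡ evenSum (suc N) k e + oddSum N k (e ∘ suc)
evenSum-suc N k e = begin
  1 * e 0 + sumBelow N (λ i → (suc k C (2 * suc i)) * e (suc i))
    ≡⟨ cong (1 * e 0 +_) (trans (sumBelow-cong N split) (sumBelow-+ N _ _)) ⟩
  1 * e 0 + (sumBelow N (λ i → (k C (2 * suc i)) * e (suc i)) + oddSum N k (e ∘ suc))
    ≡⟨ +-assoc (1 * e 0) _ _ ⟨
  evenSum (suc N) k e + oddSum N k (e ∘ suc) ∎
  where
  split : ∀ i → (suc k C (2 * suc i)) * e (suc i)
              ≡ (k C (2 * suc i)) * e (suc i) + (k C suc (2 * i)) * e (suc i)
  split i = begin
    (suc k C (2 * suc i)) * e (suc i)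
      ≡⟨ cong (λ m → (suc k C m) * e (suc i)) (*-suc 2 i) ⟩
    (suc k C (2 + 2 * i)) * e (suc i)
      ≡⟨ cong (_* e (suc i)) (trans (pascal k (suc (2 * i))) (+-comm (k C suc (2 * i)) _)) ⟩
    (k C (2 + 2 * i) + k C suc (2 * i)) * e (suc i)
      ≡⟨ *-distribʳ-+ (e (suc i)) (k C (2 + 2 * i)) _ ⟩
    (k C (2 + 2 * i)) * e (suc i) + (k C suc (2 * i)) * e (suc i)
      ≡⟨ cong (λ m → (k C m) * e (suc i) + (k C suc (2 * i)) * e (suc i)) (*-suc 2 i) ⟨
    (k C (2 * suc i)) * e (suc i) + (k C suc (2 * i)) * e (suc i) ∎

oddSum-suc : ∀ N k e → oddSum N (suc k) e ≡ oddSum N k e + evenSum N k e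
oddSum-suc N k e = trans (sumBelow-cong N split) (sumBelow-+ N _ _)
  where
  split : ∀ i → (suc k C suc (2 * i)) * e i ≡ (k C suc (2 * i)) * e i + (k C (2 * i)) * e i
  split i = trans (cong (_* e i) (trans (pascal k (2 * i)) (+-comm (k C (2 * i)) _)))
                  (*-distribʳ-+ (e i) (k C suc (2 * i)) _)

-- Pascal's rule mixes even and odd lower indices, so both parities are treated by one mutual
-- induction on `k`. The bounds on `N` ensure that the truncated sums contain all nonzero terms.
evenSum-binomialTransform : ∀ N k e → k < N → evenSum N k e ≡ binomialTransform (interleave e) k
oddSum-binomialTransform  : ∀ N k e → k ≤ N → oddSum N k e ≡ binomialTransform (shiftʳ (interleave e)) k

evenSum-binomialTransform (suc N) zero e _ =
  trans (cong₂ _+_ (*-identityˡ (e 0)) (sumBelow-0 N (λ _ → refl))) (+-identityʳ (e 0))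
evenSum-binomialTransform (suc N) (suc k) e (s≤s k<N) = begin
  evenSum (suc N) (suc k) e
    ≡⟨ evenSum-suc N k e ⟩
  evenSum (suc N) k e + oddSum N k (e ∘ suc)
    ≡⟨ cong₂ _+_ (evenSum-binomialTransform (suc N) k e (m≤n⇒m≤1+n k<N))
                 (oddSum-binomialTransform N k (e ∘ suc) (<⇒≤ k<N)) ⟩
  binomialTransform (interleave e) k + binomialTransform (shiftʳ (interleave (e ∘ suc))) k
    ≡⟨ cong (binomialTransform (interleave e) k +_) (binomialTransform-cong (interleave-suc e) k) ⟩
  binomialTransform (interleave e) (suc k) ∎

oddSum-binomialTransform N zero    e _   = sumBelow-0 N (λ _ → refl)
oddSum-binomialTransform N (suc k) e k<N =
  trans (oddSum-suc N k e)
        (cong₂ _+_ (oddSum-binomialTransform N k e (<⇒≤ k<N)) (evenSum-binomialTransform N k e k<N))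

-- A Motzkin path from 0 to 0 is a choice of its `n` non-level steps among `k` together with a ±1
-- path on them; only even `n` contribute, with Catalan weights.
motzkin-ballot : ∀ k → motzkin k ≡ binomialTransform (λ n → ballot n 0) k
motzkin-ballot k = begin
  motzkin k
    ≡⟨ cong sum (map-upTo (λ i → (k C (2 * i)) * catalan i) (suc k)) ⟩
  evenSum (suc k) k catalan
    ≡⟨ evenSum-binomialTransform (suc k) k catalan ≤-refl ⟩
  binomialTransform (interleave catalan) k
    ≡⟨ binomialTransform-cong (interleave-unique catalan (λ n → ballot n 0) ballot-catalan odds) k ⟨
  binomialTransform (λ n → ballot n 0) k ∎
  where
  double : ∀ i → suc (2 * i) + 0 ≡ suc (i + i)
  double = solve-∀
  odds : ∀ i → ballot (suc (2 * i)) 0 ≡ 0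
  odds i = ballot-odd (suc (2 * i)) 0 i (double i)

-- Counts the k-step nonnegative walks from height a whose steps rise by one or
-- fall by any positive amount; the closed form is read off the generating
-- function M (1 + z M)ᵃ, with M that of the Motzkin numbers.
walks : ℕ → ℕ → ℕ
walks k a = binomialTransform (λ j → binomialTransform (λ n → ballot n j) k) a

walks-zero : ∀ a → walks 0 a ≡ 1
walks-zero zero    = refl
walks-zero (suc a) = cong₂ _+_ (walks-zero a) (binomialTransform-0 a)

-- The inner transform counts Motzkin paths from `j` to 0, and splitting off their first step gives
-- the level, up and down terms. The outer transform turns this into the step of the level-free
-- walks.
walks-suc : ∀ k a → walks (suc k) a ≡ sumBelow a (walks k) + walks k (suc a)
walks-suc k a = trans (binomialTransform-cong step a) (binomialTransform-motzkinStep motzkinPaths a)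
  where
  motzkinPaths : ℕ → ℕ
  motzkinPaths j = binomialTransform (λ n → ballot n j) k
  shift : ∀ j → binomialTransform (λ n → shiftʳ (ballot n) j) k ≡ shiftʳ motzkinPaths j
  shift zero    = binomialTransform-0 k
  shift (suc j) = refl
  step : ∀ j → binomialTransform (λ n → ballot n j) (suc k)
             ≡ motzkinPaths j + (motzkinPaths (suc j) + shiftʳ motzkinPaths j)
  step j = cong (motzkinPaths j +_)
    (trans (binomialTransform-+ (λ n → ballot n (suc j)) _ k) (cong (motzkinPaths (suc j) +_) (shift j)))

-- Semiperimeters

-- Written with `does` so that it agrees definitionally with the summand of `lev`.
indicator : ∀ {A : Set} → Dec A → ℕ
indicator d = if does d then 1 else 0

indicator-yes : ∀ {A : Set} (d : Dec A) → A → indicator d ≡ 1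
indicator-yes (yes _) a = refl
indicator-yes (no ¬a) a = ⊥-elim (¬a a)

indicator-no : ∀ {A : Set} (d : Dec A) → ¬ A → indicator d ≡ 0
indicator-no (yes a) ¬a = ⊥-elim (¬a a)
indicator-no (no _)  ¬a = refl

indicator-⇔ : ∀ {A B : Set} (a : Dec A) (b : Dec B) → (A → B) → (B → A) → indicator a ≡ indicator b
indicator-⇔ a (yes b) f g = indicator-yes a (g b)
indicator-⇔ a (no ¬b) f g = indicator-no a (¬b ∘ f)

sumOver : ∀ {A : Set} → (A → ℕ) → List A → ℕ
sumOver f xs = sum (map f xs)

sumOver-++ : ∀ {A : Set} (f : A → ℕ) xs ys → sumOver f (xs ++ ys) ≡ sumOver f xs + sumOver f ys
sumOver-++ f xs ys = trans (cong sum (map-++ f xs ys)) (sum-++ (map f xs) (map f ys))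

sumOver-+ : ∀ {A : Set} (f g : A → ℕ) xs → sumOver (λ x → f x + g x) xs ≡ sumOver f xs + sumOver g xs
sumOver-+ f g []       = refl
sumOver-+ f g (x ∷ xs) = trans (cong (f x + g x +_) (sumOver-+ f g xs)) (+-interchange (f x) (g x) _ _)

sumOver-concatMap : ∀ {A B : Set} (f : B → ℕ) (g : A → List B) xs →
  sumOver f (concatMap g xs) ≡ sumOver (sumOver f ∘ g) xs
sumOver-concatMap f g []       = refl
sumOver-concatMap f g (x ∷ xs) =
  trans (sumOver-++ f (g x) (concatMap g xs)) (cong (sumOver f (g x) +_) (sumOver-concatMap f g xs))

length-filter-sumOver : ∀ {A : Set} {P : A → Set} (P? : Decidable P) xs →
  length (filter P? xs) ≡ sumOver (indicator ∘ P?) xs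
length-filter-sumOver P? []       = refl
length-filter-sumOver P? (x ∷ xs) with does (P? x)
... | true  = cong suc (length-filter-sumOver P? xs)
... | false = length-filter-sumOver P? xs

-- Multiplicities of cells

occurrences : List Cell → Cell → ℕ
occurrences cs c = sumOver (λ c′ → indicator (c ≟ᴱ c′)) cs

occurrences-++ : ∀ cs ds c → occurrences (cs ++ ds) c ≡ occurrences cs c + occurrences ds c
occurrences-++ cs ds c = sumOver-++ _ cs ds

sumOver-column : ∀ (f : Cell → ℕ) i h → sumOver f (column i h) ≡ sumBelow h (λ k → f (i , i + k))
sumOver-column f i h = cong sum (trans (sym (map-∘ (upTo h))) (map-upTo _ h))

occurrences-column : ∀ i h c → occurrences (column i h) c ≡ sumBelow h (λ k → indicator (c ≟ᴱ (i , i + k)))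
occurrences-column i h c = sumOver-column (λ d → indicator (c ≟ᴱ d)) i h

occurrences-otherColumn : ∀ i h x y → x ≢ i → occurrences (column i h) (x , y) ≡ 0
occurrences-otherColumn i h x y x≢i = trans (occurrences-column i h (x , y))
  (sumBelow-0 h (λ k → indicator-no ((x , y) ≟ᴱ (i , i + k)) (x≢i ∘ cong proj₁)))

-- Column `i` starts at row `i`, so every listed cell lies on or above the diagonal.
occurrences-belowDiagonal : ∀ i hs x y → y < x → occurrences (cellsFrom i hs) (x , y) ≡ 0
occurrences-belowDiagonal i []       x y y<x = refl
occurrences-belowDiagonal i (h ∷ hs) x y y<x =
  trans (occurrences-++ (column i h) (cellsFrom (suc i) hs) (x , y))
    (cong₂ _+_ (trans (occurrences-column i h (x , y))
                  (sumBelow-0 h (λ k → indicator-no ((x , y) ≟ᴱ (i , i + k)) λ where refl → <⇒≱ y<x (m≤m+n i k))))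
               (occurrences-belowDiagonal (suc i) hs x y y<x))

sumBelow-indicator-≟ : ∀ h k → sumBelow h (λ j → indicator (k ≟ j)) ≡ indicator (k <? h)
sumBelow-indicator-≟ zero    k       = refl
sumBelow-indicator-≟ (suc h) zero    = cong suc (sumBelow-0 h (λ _ → refl))
sumBelow-indicator-≟ (suc h) (suc k) = sumBelow-indicator-≟ h k

occurrences-ownColumn : ∀ i h k → occurrences (column i h) (i , i + k) ≡ indicator (k <? h)
occurrences-ownColumn i h k = begin
  occurrences (column i h) (i , i + k)                          ≡⟨ occurrences-column i h (i , i + k) ⟩
  sumBelow h (λ j → indicator ((i , i + k) ≟ᴱ (i , i + j)))     ≡⟨ sumBelow-cong h same ⟩
  sumBelow h (λ j → indicator (k ≟ j))                          ≡⟨ sumBelow-indicator-≟ h k ⟩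
  indicator (k <? h)                                            ∎
  where
  same : ∀ j → indicator ((i , i + k) ≟ᴱ (i , i + j)) ≡ indicator (k ≟ j)
  same j = indicator-⇔ ((i , i + k) ≟ᴱ (i , i + j)) (k ≟ j) (+-cancelˡ-≡ i k j ∘ cong proj₂) (cong (λ l → i , i + l))

occurrences-leftOf : ∀ i hs x y → x < i → occurrences (cellsFrom i hs) (x , y) ≡ 0
occurrences-leftOf i []       x y x<i = refl
occurrences-leftOf i (h ∷ hs) x y x<i =
  trans (occurrences-++ (column i h) (cellsFrom (suc i) hs) (x , y))
    (cong₂ _+_ (occurrences-otherColumn i h x y (<⇒≢ x<i)) (occurrences-leftOf (suc i) hs x y (m≤n⇒m≤1+n x<i)))

record HasColumn (o : Cell → ℕ) (i h : ℕ) : Set where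
  field occursAt : ∀ k → o (i , i + k) ≡ indicator (k <? h)
open HasColumn

-- The empty list still records a column of height 0, so that the last column of a polyomino has a
-- right neighbour like all others.
data HasColumns (o : Cell → ℕ) : ℕ → List ℕ → Set where
  []  : ∀ {i} → HasColumn o i 0 → HasColumns o i []
  _∷_ : ∀ {i h hs} → HasColumn o i h → HasColumns o (suc i) hs → HasColumns o i (h ∷ hs)

-- Agreement is required only from column `i` on. It thus survives the removal of the first column
-- while `o` keeps counting in the whole polyomino.
hasColumns : ∀ o i hs → (∀ x y → i ≤ x → o (x , y) ≡ occurrences (cellsFrom i hs) (x , y)) →
             HasColumns o i hs
hasColumns o i []       agree = [] (record { occursAt = λ k → agree i (i + k) ≤-refl })
hasColumns o i (h ∷ hs) agree = first ∷ hasColumns o (suc i) hs rest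
  where
  first : HasColumn o i h
  first .occursAt k = begin
    o (i , i + k)                                ≡⟨ agree i (i + k) ≤-refl ⟩
    occurrences (column i h ++ cellsFrom (suc i) hs) (i , i + k)
      ≡⟨ occurrences-++ (column i h) (cellsFrom (suc i) hs) (i , i + k) ⟩
    occurrences (column i h) (i , i + k) + occurrences (cellsFrom (suc i) hs) (i , i + k)
      ≡⟨ cong₂ _+_ (occurrences-ownColumn i h k) (occurrences-leftOf (suc i) hs i (i + k) ≤-refl) ⟩
    indicator (k <? h) + 0                       ≡⟨ +-identityʳ _ ⟩
    indicator (k <? h)                           ∎
  rest : ∀ x y → i < x → o (x , y) ≡ occurrences (cellsFrom (suc i) hs) (x , y)
  rest x y i<x = trans (agree x y (<⇒≤ i<x))
    (trans (occurrences-++ (column i h) (cellsFrom (suc i) hs) (x , y))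
           (cong (_+ occurrences (cellsFrom (suc i) hs) (x , y)) (occurrences-otherColumn i h x y (≢-sym (<⇒≢ i<x)))))

-- Both edge maps send a cell c to the edges named c and `next c`, where `next`
-- moves one unit up or right; an edge `next c` therefore lies on the cells
-- `next c` and c only.
module Boundary (next : Cell → Cell) (next-injective : ∀ {c d} → next c ≡ next d → c ≡ d)
                (next≢ : ∀ c → next c ≢ c) where

  edges : Cell → List Edge
  edges c = c ∷ next c ∷ []

  degree : List Cell → Edge → ℕ
  degree cs e = length (cellsContaining edges cs e)

  degree-next : ∀ cs c → degree cs (next c) ≡ occurrences cs (next c) + occurrences cs c
  degree-next cs c = begin
    degree cs (next c)
      ≡⟨ length-filter-sumOver (λ d → next c ∈? edges d) cs ⟩
    sumOver (λ d → indicator (next c ∈? edges d)) cs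
      ≡⟨ cong sum (map-cong split cs) ⟩
    sumOver (λ d → indicator (next c ≟ᴱ d) + indicator (c ≟ᴱ d)) cs
      ≡⟨ sumOver-+ _ _ cs ⟩
    occurrences cs (next c) + occurrences cs c ∎
    where
    split : ∀ d → indicator (next c ∈? edges d) ≡ indicator (next c ≟ᴱ d) + indicator (c ≟ᴱ d)
    split d = cases (next c ≟ᴱ d) (c ≟ᴱ d)
      where
      cases : (p? : Dec (next c ≡ d)) (q? : Dec (c ≡ d)) →
              indicator (next c ∈? edges d) ≡ indicator p? + indicator q?
      cases (yes p) (yes q) = ⊥-elim (next≢ c (trans p (sym q)))
      cases (yes p) (no _)  = indicator-yes (next c ∈? edges d) (here p)
      cases (no _)  (yes q) = indicator-yes (next c ∈? edges d) (there (here (cong next q)))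
      cases (no ¬p) (no ¬q) = indicator-no (next c ∈? edges d) λ where
        (here p)         → ¬p p
        (there (here q)) → ¬q (next-injective q)

  boundaryEdges : List Cell → Cell → ℕ
  boundaryEdges cs c = indicator (degree cs c ≟ 1) + indicator (degree cs (next c) ≟ 1)

  length-boundary : ∀ cs → length (boundary edges cs) ≡ sumOver (boundaryEdges cs) cs
  length-boundary cs = begin
    length (boundary edges cs)
      ≡⟨ length-filter-sumOver (λ e → degree cs e ≟ 1) (concatMap edges cs) ⟩
    sumOver (λ e → indicator (degree cs e ≟ 1)) (concatMap edges cs)
      ≡⟨ sumOver-concatMap _ edges cs ⟩
    sumOver (λ c → indicator (degree cs c ≟ 1) + (indicator (degree cs (next c) ≟ 1) + 0)) cs
      ≡⟨ cong sum (map-cong (λ c → cong (indicator (degree cs c ≟ 1) +_) (+-identityʳ _)) cs) ⟩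
    sumOver (boundaryEdges cs) cs ∎

  -- Both edges of a cell that occurs once have degree 1 plus the multiplicity of the neighbour
  -- across, so they are on the boundary exactly when that neighbour is absent. Writing the cell as
  -- `next c` gives access to its predecessor.
  boundaryEdges-next : ∀ cs c → occurrences cs (next c) ≡ 1 →
    boundaryEdges cs (next c) ≡ indicator (occurrences cs c ≟ 0) + indicator (occurrences cs (next (next c)) ≟ 0)
  boundaryEdges-next cs c once = cong₂ _+_
    (cong (λ d → indicator (d ≟ 1)) (trans (degree-next cs c) (cong (_+ occurrences cs c) once)))
    (cong (λ d → indicator (d ≟ 1))
      (trans (degree-next cs (next c)) (trans (cong (occurrences cs (next (next c)) +_) once) (+-comm (occurrences cs (next (next c))) 1))))

right up : Cell → Cell
right (x , y) = suc x , y
up    (x , y) = x , suc y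

right-injective : ∀ {c d} → right c ≡ right d → c ≡ d
right-injective refl = refl

up-injective : ∀ {c d} → up c ≡ up d → c ≡ d
up-injective refl = refl

right≢ : ∀ c → right c ≢ c
right≢ _ ()

up≢ : ∀ c → up c ≢ c
up≢ _ ()

module Vertical   = Boundary right right-injective right≢
module Horizontal = Boundary up up-injective up≢

-- Boundary edges column by column

sumBelow-absent : ∀ h q → sumBelow h (λ k → indicator (indicator (k <? q) ≟ 0)) ≡ h ∸ q
sumBelow-absent zero    q       = sym (0∸n≡0 q)
sumBelow-absent (suc h) zero    = cong suc (sumBelow-absent h 0)
sumBelow-absent (suc h) (suc q) = sumBelow-absent h q

-- Both the left neighbour and the cell above sit one row higher relative to the bottom of their
-- column, so that column counts with the predecessor of its height.
indicator-<?-pred : ∀ k p → indicator (suc k <? p) ≡ indicator (k <? pred p)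
indicator-<?-pred k zero    = refl
indicator-<?-pred k (suc p) = refl

firstHeight : List ℕ → ℕ
firstHeight []      = 0
firstHeight (h ∷ _) = h

-- The parameter p is the height of the column to the left (0 if there is none).
verticalCount : ℕ → List ℕ → ℕ
verticalCount p []       = 0
verticalCount p (h ∷ hs) = (h ∸ pred p) + suc (pred h ∸ firstHeight hs) + verticalCount h hs

module _ (cs : List Cell) (belowDiagonal : ∀ x y → y < x → occurrences cs (x , y) ≡ 0) where

  private
    o = occurrences cs

  -- The bottom cell of column `i` faces a cell below the diagonal, which is absent and gives the
  -- `suc`. The other `pred h` rows face column `suc i` from its bottom upwards.
  nextDiagonal : ∀ i h {h′} → HasColumn o (suc i) h′ → 1 ≤ h →
    sumBelow h (λ k → indicator (o (suc i , i + k) ≟ 0)) ≡ suc (pred h ∸ h′)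
  nextDiagonal i (suc h) {h′} col _ = cong₂ _+_
    (cong (λ n → indicator (n ≟ 0)) (belowDiagonal (suc i) (i + 0) (s≤s (≤-reflexive (+-identityʳ i)))))
    (trans (sumBelow-cong h (λ k → cong (λ n → indicator (n ≟ 0))
              (trans (cong (λ y → o (suc i , y)) (+-suc i k)) (occursAt col k))))
           (sumBelow-absent h h′))

  present : ∀ {i h} → HasColumn o i h → ∀ k → k < h → o (i , i + k) ≡ 1
  present {h = h} col k k<h = trans (occursAt col k) (indicator-yes (k <? h) k<h)

  verticalColumn : ∀ {i p h h′} → HasColumn o i p → HasColumn o (suc i) h → HasColumn o (2 + i) h′ → 1 ≤ h →
    sumOver (Vertical.boundaryEdges cs) (column (suc i) h) ≡ (h ∸ pred p) + suc (pred h ∸ h′)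
  verticalColumn {i} {p} {h} {h′} left own right 1≤h = begin
    sumOver (Vertical.boundaryEdges cs) (column (suc i) h)
      ≡⟨ sumOver-column _ (suc i) h ⟩
    sumBelow h (λ k → Vertical.boundaryEdges cs (suc i , suc i + k))
      ≡⟨ sumBelow-cong-< h (λ k k<h → Vertical.boundaryEdges-next cs (i , suc i + k) (present own k k<h)) ⟩
    sumBelow h (λ k → indicator (o (i , suc i + k) ≟ 0) + indicator (o (2 + i , suc i + k) ≟ 0))
      ≡⟨ sumBelow-+ h _ _ ⟩
    sumBelow h (λ k → indicator (o (i , suc i + k) ≟ 0)) + sumBelow h (λ k → indicator (o (2 + i , suc i + k) ≟ 0))
      ≡⟨ cong₂ _+_ (trans (sumBelow-cong h leftAbsent) (sumBelow-absent h (pred p))) (nextDiagonal (suc i) h right 1≤h) ⟩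
    (h ∸ pred p) + suc (pred h ∸ h′) ∎
    where
    leftAbsent : ∀ k → indicator (o (i , suc i + k) ≟ 0) ≡ indicator (indicator (k <? pred p) ≟ 0)
    leftAbsent k = cong (λ n → indicator (n ≟ 0))
      (trans (cong (λ y → o (i , y)) (sym (+-suc i k))) (trans (occursAt left (suc k)) (indicator-<?-pred k p)))

  horizontalColumn : ∀ {i h} → HasColumn o (suc i) h → 1 ≤ h →
    sumOver (Horizontal.boundaryEdges cs) (column (suc i) h) ≡ 2
  horizontalColumn {i} {h} own 1≤h = begin
    sumOver (Horizontal.boundaryEdges cs) (column (suc i) h)
      ≡⟨ sumOver-column _ (suc i) h ⟩
    sumBelow h (λ k → Horizontal.boundaryEdges cs (suc i , suc i + k))
      ≡⟨ sumBelow-cong-< h (λ k k<h → Horizontal.boundaryEdges-next cs (suc i , i + k) (present own k k<h)) ⟩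
    sumBelow h (λ k → indicator (o (suc i , i + k) ≟ 0) + indicator (o (suc i , 2 + i + k) ≟ 0))
      ≡⟨ sumBelow-+ h _ _ ⟩
    sumBelow h (λ k → indicator (o (suc i , i + k) ≟ 0)) + sumBelow h (λ k → indicator (o (suc i , 2 + i + k) ≟ 0))
      -- The cells directly below column `suc i` occupy the positions `(suc i , i + k)`, so
      -- `nextDiagonal` applies with the column itself as the facing one.
      ≡⟨ cong₂ _+_ (nextDiagonal i h own 1≤h) (trans (sumBelow-cong h aboveAbsent) (sumBelow-absent h (pred h))) ⟩
    suc (pred h ∸ h) + (h ∸ pred h)
      ≡⟨ single 1≤h ⟩
    2 ∎
    where
    aboveAbsent : ∀ k → indicator (o (suc i , 2 + i + k) ≟ 0) ≡ indicator (indicator (k <? pred h) ≟ 0)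
    aboveAbsent k = cong (λ n → indicator (n ≟ 0))
      (trans (cong (λ y → o (suc i , suc y)) (sym (+-suc i k))) (trans (occursAt own (suc k)) (indicator-<?-pred k h)))
    single : ∀ {h} → 1 ≤ h → suc (pred h ∸ h) + (h ∸ pred h) ≡ 2
    single {suc h} _ = cong₂ (λ a b → suc a + b) (m≤n⇒m∸n≡0 (n≤1+n h)) (m+n∸n≡m 1 h)

  horizontalSum : ∀ {i hs} → HasColumns o (suc i) hs → All (1 ≤_) hs →
    sumOver (Horizontal.boundaryEdges cs) (cellsFrom (suc i) hs) ≡ 2 * length hs
  horizontalSum ([] _)       []              = refl
  horizontalSum {i} {h ∷ hs} (own ∷ rest) (1≤h ∷ 1≤hs) = begin
    sumOver (Horizontal.boundaryEdges cs) (column (suc i) h ++ cellsFrom (2 + i) hs)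
      ≡⟨ sumOver-++ _ (column (suc i) h) _ ⟩
    sumOver (Horizontal.boundaryEdges cs) (column (suc i) h) + sumOver (Horizontal.boundaryEdges cs) (cellsFrom (2 + i) hs)
      ≡⟨ cong₂ _+_ (horizontalColumn own 1≤h) (horizontalSum rest 1≤hs) ⟩
    2 + 2 * length hs
      ≡⟨ *-suc 2 (length hs) ⟨
    2 * suc (length hs) ∎

  firstColumn : ∀ {i hs} → HasColumns o i hs → HasColumn o i (firstHeight hs)
  firstColumn ([] col)  = col
  firstColumn (col ∷ _) = col

  verticalSum : ∀ {i p hs} → HasColumn o i p → HasColumns o (suc i) hs → All (1 ≤_) hs →
    sumOver (Vertical.boundaryEdges cs) (cellsFrom (suc i) hs) ≡ verticalCount p hs
  verticalSum left ([] _)       []           = refl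
  verticalSum {i} {p} {h ∷ hs} left (own ∷ rest) (1≤h ∷ 1≤hs) =
    trans (sumOver-++ _ (column (suc i) h) _)
      (cong₂ _+_ (verticalColumn left own (firstColumn rest) 1≤h) (verticalSum own rest 1≤hs))

-- The vertical semiperimeter formula

m+[n∸m]≡n+[m∸n] : ∀ m n → m + (n ∸ m) ≡ n + (m ∸ n)
m+[n∸m]≡n+[m∸n] zero    zero    = refl
m+[n∸m]≡n+[m∸n] zero    (suc n) = sym (+-identityʳ (suc n))
m+[n∸m]≡n+[m∸n] (suc m) zero    = +-identityʳ (suc m)
m+[n∸m]≡n+[m∸n] (suc m) (suc n) = cong suc (m+[n∸m]≡n+[m∸n] m n)

-- hₘ + ∑ (1 + max (0, hᵢ − hᵢ₊₁ − 1)).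
verticalSemi : List ℕ → ℕ
verticalSemi []           = 0
verticalSemi (h ∷ [])     = h
verticalSemi (h ∷ g ∷ hs) = suc ((pred h ∸ g) + verticalSemi (g ∷ hs))

-- Left overhangs are traded for right overhangs, since `q + (h ∸ q)` and `h + (q ∸ h)` are both the
-- maximum of `q` and `h`. The terms `pred p` and `pred p ∸ h` are the correction due to the left
-- neighbour, and they vanish for `p = 0`.
verticalCount-verticalSemi : ∀ p h hs → All (1 ≤_) (h ∷ hs) →
  verticalCount p (h ∷ hs) + pred p ≡ 2 * verticalSemi (h ∷ hs) + (pred p ∸ h)
verticalCount-verticalSemi p h@(suc h₀) [] (_ ∷ []) = begin
  (h ∸ q) + suc h₀ + 0 + q   ≡⟨ regroup (h ∸ q) h q ⟩
  h + (q + (h ∸ q))          ≡⟨ cong (h +_) (m+[n∸m]≡n+[m∸n] q h) ⟩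
  h + (h + (q ∸ h))          ≡⟨ collect h (q ∸ h) ⟩
  2 * h + (q ∸ h)            ∎
  where
  q = pred p
  regroup : ∀ a h q → a + h + 0 + q ≡ h + (q + a)
  regroup = solve-∀
  collect : ∀ h b → h + (h + b) ≡ 2 * h + b
  collect = solve-∀
verticalCount-verticalSemi p h@(suc h₀) (g ∷ hs) (_ ∷ 1≤hs) = begin
  (h ∸ q) + suc e + v + q            ≡⟨ regroup (h ∸ q) e v q ⟩
  suc e + v + (q + (h ∸ q))          ≡⟨ cong (suc e + v +_) (m+[n∸m]≡n+[m∸n] q h) ⟩
  suc e + v + (h + (q ∸ h))          ≡⟨ expose h₀ e v (q ∸ h) ⟩
  (v + h₀) + (2 + e + (q ∸ h))       ≡⟨ cong (_+ (2 + e + (q ∸ h))) (verticalCount-verticalSemi h g hs 1≤hs) ⟩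
  (2 * s + e) + (2 + e + (q ∸ h))    ≡⟨ collect s e (q ∸ h) ⟩
  2 * suc (e + s) + (q ∸ h)          ∎
  where
  q = pred p
  e = h₀ ∸ g
  v = verticalCount h (g ∷ hs)
  s = verticalSemi (g ∷ hs)
  regroup : ∀ a e v q → a + suc e + v + q ≡ suc e + v + (q + a)
  regroup = solve-∀
  expose : ∀ h e v b → suc e + v + (suc h + b) ≡ (v + h) + (2 + e + b)
  expose = solve-∀
  collect : ∀ s e b → (2 * s + e) + (2 + e + b) ≡ 2 * suc (e + s) + b
  collect = solve-∀

IsFibonacci⇒positive : ∀ {P} → IsFibonacci P → All (1 ≤_) P
IsFibonacci⇒positive (last 1≤h)     = 1≤h ∷ []
IsFibonacci⇒positive (next 2≤h fib) = <⇒≤ 2≤h ∷ IsFibonacci⇒positive fib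

cells-belowDiagonal : ∀ P x y → y < x → occurrences (cells P) (x , y) ≡ 0
cells-belowDiagonal = occurrences-belowDiagonal 1

cells-columns : ∀ P → HasColumns (occurrences (cells P)) 1 P
cells-columns P = hasColumns _ 1 P (λ _ _ _ → refl)

horizontal-boundary : ∀ {P} → IsFibonacci P → length (boundary horizontalEdges (cells P)) ≡ 2 * length P
horizontal-boundary {P} fib = trans (Horizontal.length-boundary (cells P))
  (horizontalSum (cells P) (cells-belowDiagonal P) (cells-columns P) (IsFibonacci⇒positive fib))

vertical-boundary : ∀ {P} → IsFibonacci P → length (boundary verticalEdges (cells P)) ≡ 2 * verticalSemi P
vertical-boundary {P@(h ∷ hs)} fib = begin
  length (boundary verticalEdges (cells P))
    ≡⟨ Vertical.length-boundary (cells P) ⟩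
  sumOver (Vertical.boundaryEdges (cells P)) (cells P)
    ≡⟨ verticalSum (cells P) (cells-belowDiagonal P) column₀ (cells-columns P) positive ⟩
  verticalCount 0 P
    ≡⟨ +-identityʳ _ ⟨
  verticalCount 0 P + 0
    ≡⟨ verticalCount-verticalSemi 0 h hs positive ⟩
  2 * verticalSemi P + (0 ∸ h)
    ≡⟨ trans (cong (2 * verticalSemi P +_) (0∸n≡0 h)) (+-identityʳ _) ⟩
  2 * verticalSemi P ∎
  where
  positive = IsFibonacci⇒positive fib
  column₀ : HasColumn (occurrences (cells P)) 0 0
  -- The cells begin in column 1, so the first column has a left neighbour of height 0.
  column₀ .occursAt k = occurrences-leftOf 1 P 0 k z<s

-- Enumeration by levels

-- The case of equality in `verticalSemi-≥`.
data Steep : List ℕ → Set where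
  base : Steep [ 1 ]
  step : ∀ {h g hs} → 2 ≤ h → h ≤ suc g → Steep (g ∷ hs) → Steep (h ∷ g ∷ hs)

verticalSemi-≥ : ∀ {P} → IsFibonacci P → length P ≤ verticalSemi P
verticalSemi-≥ (last 1≤h) = 1≤h
verticalSemi-≥ (next {hs = _ ∷ _} _ fib) = s≤s (≤-trans (verticalSemi-≥ fib) (m≤n+m _ _))

steep⇒fibonacci : ∀ {P} → Steep P → IsFibonacci P
steep⇒fibonacci base              = last ≤-refl
steep⇒fibonacci (step 2≤h _ steep) = next 2≤h (steep⇒fibonacci steep)

steep⇒verticalSemi : ∀ {P} → Steep P → verticalSemi P ≡ length P
steep⇒verticalSemi base                = refl
steep⇒verticalSemi (step _ h≤1+g steep) =
  cong suc (cong₂ _+_ (m≤n⇒m∸n≡0 (pred-mono-≤ h≤1+g)) (steep⇒verticalSemi steep))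

-- Every column contributes at least 1 to `verticalSemi`, so equality with the length leaves no room
-- for any excess `pred h ∸ g`.
verticalSemi⇒steep : ∀ {P} → IsFibonacci P → verticalSemi P ≡ length P → Steep P
verticalSemi⇒steep (last _) refl = base
verticalSemi⇒steep {h ∷ g ∷ hs} (next 2≤h fib) eq =
  step 2≤h (suc-pred-≤ (m∸n≡0⇒m≤n excess≡0)) (verticalSemi⇒steep fib (trans (cong (_+ verticalSemi (g ∷ hs)) (sym excess≡0)) (suc-injective eq)))
  where
  excess≡0 : pred h ∸ g ≡ 0
  excess≡0 = n≤0⇒n≡0 (+-cancelʳ-≤ (length (g ∷ hs)) (pred h ∸ g) 0
    (≤-trans (+-monoʳ-≤ (pred h ∸ g) (verticalSemi-≥ fib)) (≤-reflexive (suc-injective eq))))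
  suc-pred-≤ : ∀ {h g} → pred h ≤ g → h ≤ suc g
  suc-pred-≤ {zero}  _   = z≤n
  suc-pred-≤ {suc h} h≤g = s≤s h≤g

𝓕⇔steep : ∀ n P → 𝓕 n n P ⇔ (Steep P × length P ≡ n)
𝓕⇔steep n P = mk⇔ to from
  where
  to : 𝓕 n n P → Steep P × length P ≡ n
  to (fib , horizontal , vertical) = verticalSemi⇒steep fib (trans semi≡n (sym length≡n)) , length≡n
    where
    length≡n : length P ≡ n
    length≡n = *-cancelˡ-≡ _ _ 2 (trans (sym (horizontal-boundary fib)) horizontal)
    semi≡n : verticalSemi P ≡ n
    semi≡n = *-cancelˡ-≡ _ _ 2 (trans (sym (vertical-boundary fib)) vertical)
  from : Steep P × length P ≡ n → 𝓕 n n P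
  from (steep , refl) = fib , horizontal-boundary fib
    , trans (vertical-boundary fib) (cong (2 *_) (steep⇒verticalSemi steep))
    where fib = steep⇒fibonacci steep

-- The lists obtained from (2 + a) ∷ hs by prepending m further heights, each at
-- least 2 and exceeding its right neighbour by at most 1.
extensions : ℕ → ℕ → List ℕ → List (List ℕ)
extensions zero    a hs = [ 2 + a ∷ hs ]
extensions (suc m) a hs = concatMap (λ b → extensions m b (2 + a ∷ hs)) (upTo (2 + a))

∈-extensions-suc⁻ : ∀ {m a hs P} → P ∈ extensions (suc m) a hs →
  ∃[ b ] b < 2 + a × P ∈ extensions m b (2 + a ∷ hs)
∈-extensions-suc⁻ {m} {a} {hs} P∈ with find (∈-concatMap⁻ (λ b → extensions m b (2 + a ∷ hs)) P∈)
... | b , b∈ , P∈′ = b , ∈-upTo⁻ b∈ , P∈′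

∈-extensions-suc⁺ : ∀ {m a hs P b} → b < 2 + a → P ∈ extensions m b (2 + a ∷ hs) →
  P ∈ extensions (suc m) a hs
∈-extensions-suc⁺ {m} {a} {hs} b<2+a P∈ =
  ∈-concatMap⁺ (λ b → extensions m b (2 + a ∷ hs)) (lose (∈-upTo⁺ b<2+a) P∈)

extensions-steep : ∀ m {a hs P} → P ∈ extensions m a hs → Steep (2 + a ∷ hs) → Steep P
extensions-steep zero    (here refl) steep = steep
extensions-steep (suc m) {a} {hs} P∈ steep with ∈-extensions-suc⁻ {m} {a} {hs} P∈
-- Heights are written as `2 + b`: the lower bound 2 is automatic, and `b < 2 + a` says that the new
-- height is at most `suc (2 + a)`.
... | b , b<2+a , P∈′ = extensions-steep m P∈′ (step (s≤s (s≤s z≤n)) (s≤s b<2+a) steep)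

extensions-length : ∀ m {a hs P} → P ∈ extensions m a hs → length P ≡ m + suc (length hs)
extensions-length zero    (here refl) = refl
extensions-length (suc m) {a} {hs} P∈ with ∈-extensions-suc⁻ {m} {a} {hs} P∈
... | b , b<2+a , P∈′ = trans (extensions-length m P∈′) (+-suc m _)

-- Recovers the seed from any of its extensions, so that different seeds have disjoint extensions.
extensions-drop : ∀ m {a hs P} → P ∈ extensions m a hs → drop m P ≡ 2 + a ∷ hs
extensions-drop zero    (here refl) = refl
extensions-drop (suc m) {a} {hs} {P} P∈ with ∈-extensions-suc⁻ {m} {a} {hs} P∈
... | b , b<2+a , P∈′ = begin
  drop (suc m) P     ≡⟨ cong (λ n → drop n P) (+-comm 1 m) ⟩
  drop (m + 1) P     ≡⟨ drop-drop m 1 P ⟨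
  drop 1 (drop m P)  ≡⟨ cong (drop 1) (extensions-drop m P∈′) ⟩
  2 + a ∷ hs         ∎

-- `extensions` recurses next to the seed, whereas `Steep` is peeled off at the left end; the
-- induction carries a new leftmost height past the recursion.
extensions-prepend : ∀ m {a hs h g P} → 2 ≤ h → h ≤ suc g → g ∷ P ∈ extensions m a hs →
  h ∷ g ∷ P ∈ extensions (suc m) a hs
extensions-prepend zero {a} {hs} (s≤s (s≤s _)) (s≤s h≤g) (here refl) =
  ∈-extensions-suc⁺ {0} {a} {hs} h≤g (here refl)
extensions-prepend (suc m) {a} {hs} 2≤h h≤1+g P∈ with ∈-extensions-suc⁻ {m} {a} {hs} P∈
... | b , b<2+a , P∈′ = ∈-extensions-suc⁺ {suc m} {a} {hs} b<2+a (extensions-prepend m 2≤h h≤1+g P∈′)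

extensions-complete : ∀ m {P} → Steep P → length P ≡ 2 + m → P ∈ extensions m 0 [ 1 ]
-- The height before the final 1 lies between 2 and 1 + 1, which forces the seed (2, 1).
extensions-complete zero    (step 2≤h h≤2 base) _ with refl ← ≤-antisym h≤2 2≤h = here refl
extensions-complete (suc m) (step 2≤h h≤1+g steep) eq =
  extensions-prepend m 2≤h h≤1+g (extensions-complete m steep (suc-injective eq))

extensions⇔𝓕 : ∀ m P → P ∈ extensions m 0 [ 1 ] ⇔ 𝓕 (2 + m) (2 + m) P
extensions⇔𝓕 m P = mk⇔
  (λ P∈ → Equivalence.from (𝓕⇔steep (2 + m) P)
    (extensions-steep m P∈ (step ≤-refl ≤-refl base) , trans (extensions-length m P∈) (+-comm m 2)))
  (λ 𝓕P → let steep , length≡ = Equivalence.to (𝓕⇔steep (2 + m) P) 𝓕P in extensions-complete m steep length≡)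

extensions-unique : ∀ m a hs → Unique (extensions m a hs)
extensions-unique zero    a hs = [] AllPairs.∷ AllPairs.[]
extensions-unique (suc m) a hs = Unique.concat⁺
  (All.map⁺ (All.universal (λ b → extensions-unique m b (2 + a ∷ hs)) (upTo (2 + a))))
  (AllPairs.map⁺ (AllPairs.map disjoint (Unique.upTo⁺ (2 + a))))
  where
  disjoint : ∀ {b c} → b ≢ c → ∀ {P} → ¬ (P ∈ extensions m b (2 + a ∷ hs) × P ∈ extensions m c (2 + a ∷ hs))
  disjoint b≢c (P∈b , P∈c) = b≢c (suc-injective (suc-injective
    (∷-injectiveˡ (trans (sym (extensions-drop m P∈b)) (extensions-drop m P∈c)))))

-- Counting extensions by their levels

levelCount : ℕ → List (List ℕ) → ℕ
levelCount t Ps = sumOver (λ P → indicator (lev P ≟ t)) Ps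

lev-equal : ∀ h hs → lev (h ∷ h ∷ hs) ≡ suc (lev (h ∷ hs))
lev-equal h hs = cong (_+ lev (h ∷ hs)) (indicator-yes (h ≟ h) refl)

lev-distinct : ∀ {g h} hs → g ≢ h → lev (g ∷ h ∷ hs) ≡ lev (h ∷ hs)
lev-distinct {g} {h} hs g≢h = cong (_+ lev (h ∷ hs)) (indicator-no (g ≟ h) g≢h)

levelCount-suc : ∀ m a hs t →
  levelCount t (extensions (suc m) a hs) ≡ sumBelow (2 + a) (λ b → levelCount t (extensions m b (2 + a ∷ hs)))
levelCount-suc m a hs t = trans (sumOver-concatMap _ (λ b → extensions m b (2 + a ∷ hs)) (upTo (2 + a)))
                                (cong sum (map-upTo (λ b → levelCount t (extensions m b (2 + a ∷ hs))) (2 + a)))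

-- Prepending heights never destroys a level.
levelCount-below : ∀ m a hs t → t < lev (2 + a ∷ hs) → levelCount t (extensions m a hs) ≡ 0
levelCount-below zero    a hs t t<lev = trans (+-identityʳ _) (indicator-no (lev (2 + a ∷ hs) ≟ t) (≢-sym (<⇒≢ t<lev)))
levelCount-below (suc m) a hs t t<lev = trans (levelCount-suc m a hs t)
  (sumBelow-0 (2 + a) (λ b → levelCount-below m b (2 + a ∷ hs) t (≤-trans t<lev (m≤n+m _ _))))

-- For `t < m` the two step counts agree; otherwise truncated subtraction makes them differ, but the
-- binomial coefficient is 0.
C-*-walks : ∀ m t a → (m C suc t) * walks (suc (m ∸ suc t)) a ≡ (m C suc t) * walks (m ∸ t) a
C-*-walks m t a with t <? m
... | yes t<m = cong (λ k → (m C suc t) * walks k a) (sym (+-∸-assoc 1 t<m))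
... | no  t≮m rewrite k>n⇒nCk≡0 (s≤s (≮⇒≥ t≮m)) = refl

-- Levels are counted relative to the seed, so a new level merely moves one unit from `t` into the
-- seed. Of the heights `2 + b` to prepend, those with `b ≢ a` combine by `walks-suc`, the one with
-- `b = a` is a level step, and Pascal's rule adds the two cases.
levelCount-extensions : ∀ m a hs t →
  levelCount (lev (2 + a ∷ hs) + t) (extensions m a hs) ≡ (m C t) * walks (m ∸ t) a
levelCount-extensions zero a hs zero = begin
  indicator (L ≟ L + 0) + 0  ≡⟨ +-identityʳ _ ⟩
  indicator (L ≟ L + 0)      ≡⟨ indicator-yes (L ≟ L + 0) (sym (+-identityʳ L)) ⟩
  1                          ≡⟨ walks-zero a ⟨
  walks 0 a                  ≡⟨ *-identityˡ _ ⟨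
  1 * walks 0 a              ∎
  where L = lev (2 + a ∷ hs)
levelCount-extensions zero a hs (suc t) =
  trans (+-identityʳ _) (indicator-no (L ≟ L + suc t) (λ eq → m+1+n≢m L (sym eq)))
  where L = lev (2 + a ∷ hs)
levelCount-extensions (suc m) a hs t = begin
  levelCount (L + t) (extensions (suc m) a hs)
    ≡⟨ levelCount-suc m a hs (L + t) ⟩
  sumBelow (2 + a) count
    ≡⟨ trans (sumBelow-suc (suc a) count) (cong (_+ count (suc a)) (sumBelow-suc a count)) ⟩
  sumBelow a count + count a + count (suc a)
    ≡⟨ cong₂ (λ x y → x + count a + y)
         (trans (sumBelow-cong-< a (λ b b<a → distinct (<⇒≢ b<a))) (sumBelow-* a (m C t) (walks (m ∸ t))))
         (distinct (≢-sym (<⇒≢ (n<1+n a)))) ⟩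
  (m C t) * sumBelow a (walks (m ∸ t)) + count a + (m C t) * walks (m ∸ t) (suc a)
    ≡⟨ regroup (m C t) (sumBelow a (walks (m ∸ t))) (count a) (walks (m ∸ t) (suc a)) ⟩
  (m C t) * (sumBelow a (walks (m ∸ t)) + walks (m ∸ t) (suc a)) + count a
    ≡⟨ cong (λ w → (m C t) * w + count a) (walks-suc (m ∸ t) a) ⟨
  (m C t) * walks (suc (m ∸ t)) a + count a
    ≡⟨ finish t ⟩
  (suc m C t) * walks (suc m ∸ t) a ∎
  where
  L = lev (2 + a ∷ hs)
  count : ℕ → ℕ
  count b = levelCount (L + t) (extensions m b (2 + a ∷ hs))
  distinct : ∀ {b} → b ≢ a → count b ≡ (m C t) * walks (m ∸ t) b
  distinct {b} b≢a =
    trans (cong (λ l → levelCount (l + t) (extensions m b (2 + a ∷ hs)))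
             (sym (lev-distinct hs (b≢a ∘ suc-injective ∘ suc-injective))))
          (levelCount-extensions m b (2 + a ∷ hs) t)
  regroup : ∀ c s x w → c * s + x + c * w ≡ c * (s + w) + x
  regroup = solve-∀
  finish : ∀ t → (m C t) * walks (suc (m ∸ t)) a + levelCount (L + t) (extensions m a (2 + a ∷ hs))
               ≡ (suc m C t) * walks (suc m ∸ t) a
  -- With `t = 0` a level step already exceeds the prescribed number of levels, so this term is 0.
  finish zero = trans
    (cong (1 * walks (suc m) a +_) (levelCount-below m a (2 + a ∷ hs) (L + 0)
      (≤-reflexive (trans (cong suc (+-identityʳ L)) (sym (lev-equal (2 + a) hs))))))
    (+-identityʳ _)
  finish (suc t) = begin
    (m C suc t) * walks (suc (m ∸ suc t)) a + levelCount (L + suc t) (extensions m a (2 + a ∷ hs))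
      ≡⟨ cong₂ _+_ (C-*-walks m t a)
           (trans (cong (λ l → levelCount l (extensions m a (2 + a ∷ hs)))
                     (trans (+-suc L t) (cong (_+ t) (sym (lev-equal (2 + a) hs)))))
                  (levelCount-extensions m a (2 + a ∷ hs) t)) ⟩
    (m C suc t) * walks (m ∸ t) a + (m C t) * walks (m ∸ t) a
      ≡⟨ *-distribʳ-+ (walks (m ∸ t) a) (m C suc t) (m C t) ⟨
    (m C suc t + m C t) * walks (m ∸ t) a
      ≡⟨ cong (_* walks (m ∸ t) a) (trans (+-comm (m C suc t) (m C t)) (sym (pascal m t))) ⟩
    (suc m C suc t) * walks (m ∸ t) a ∎

𝓕-lev-cardinality : ∀ m t → HasCardinality (λ P → 𝓕 (2 + m) (2 + m) P × lev P ≡ t) ((m C t) * motzkin (m ∸ t))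
𝓕-lev-cardinality m t =
    filter lev≟t (extensions m 0 [ 1 ])
  , Unique.filter⁺ lev≟t (extensions-unique m 0 [ 1 ])
  , (λ P → mk⇔
      (λ P∈ → let P∈′ , lev≡t = ∈-filter⁻ lev≟t P∈ in Equivalence.to (extensions⇔𝓕 m P) P∈′ , lev≡t)
      (λ (𝓕P , lev≡t) → ∈-filter⁺ lev≟t (Equivalence.from (extensions⇔𝓕 m P) 𝓕P) lev≡t))
  , (begin
      length (filter lev≟t (extensions m 0 [ 1 ]))  ≡⟨ length-filter-sumOver lev≟t (extensions m 0 [ 1 ]) ⟩
      -- The seed (2, 1) has no level, so `lev (2 ∷ [ 1 ]) + t` reduces to `t`.
      levelCount t (extensions m 0 [ 1 ])           ≡⟨ levelCount-extensions m 0 [ 1 ] t ⟩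
      -- At height 0 the outer transform in `walks` is its value at 0, which leaves the transform of
      -- `motzkin-ballot`.
      (m C t) * walks (m ∸ t) 0                     ≡⟨ cong ((m C t) *_) (motzkin-ballot (m ∸ t)) ⟨
      (m C t) * motzkin (m ∸ t)                     ∎)
  where
  lev≟t : ∀ P → Dec (lev P ≡ t)
  lev≟t P = lev P ≟ t

corollary4p8 : (n : ℕ) → 2 ≤ n →
    ((t : ℕ) → t ≤ n ∸ 2 →
    HasCardinality (λ P → 𝓕 n n P × lev P ≡ t) (((n ∸ 2) C t) * motzkin ((n ∸ 2) ∸ t)))
    × ((t : ℕ) → n ∸ 2 < t →
    HasCardinality (λ P → 𝓕 n n P × lev P ≡ t) 0)
    × HasCardinality (λ P → 𝓕 n n P × lev P ≡ 0) (motzkin (n ∸ 2))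
corollary4p8 (suc (suc m)) (s≤s (s≤s _)) =
    (λ t _ → 𝓕-lev-cardinality m t)
  , (λ t m<t → subst (HasCardinality _) (cong (_* motzkin (m ∸ t)) (k>n⇒nCk≡0 m<t)) (𝓕-lev-cardinality m t))
  , subst (HasCardinality _) (*-identityˡ (motzkin m)) (𝓕-lev-cardinality m 0)
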